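{- We have the $\mathrm{des}$-Wilf equivalence $\underline{132}4\overset{\mathrm{des}}{\sim}\underline{142}3$.
   Context: $\mathfrak{S}_n$ is the set of permutations of $\{1,\ldots,n\}$ in one-line notation, and $\mathrm{des}(\pi)=|\{i\in[n-1]:\pi_i>\pi_{i+1}\}|$. An occurrence of the pattern $\underline{abc}d$ (where $abcd\in\mathfrak{S}_4$) in $\pi$ is a subsequence $\pi_i\pi_{i+1}\pi_{i+2}\pi_j$ with $j>i+2$ order-isomorphic to $abcd$. $\mathfrak{S}_n(\omega)$ is the set of permutations in $\mathfrak{S}_n$ with no occurrence of $\omega$. $\omega\overset{\mathrm{des}}{\sim}\omega'$ means $|\{\pi\in\mathfrak{S}_n(\omega):\mathrm{des}(\pi)=m\}|=|\{\pi\in\mathfrak{S}_n(\omega'):\mathrm{des}(\pi)=m\}|$ for all $n\ge1$ and $m\ge0$. -}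

module Defs where

open import Data.Fin as Fin using (Fin; toℕ)
import Data.Fin.Properties as Fin
open import Data.List as List using (List; length; filter; allFin; cartesianProductWith)
open import Data.List.Membership.Propositional using (_∈_)
open import Data.List.Membership.Propositional.Properties using (∈-allFin; ∈-cartesianProductWith⁺)
open import Data.List.Relation.Unary.All using ([])
open import Data.List.Relation.Unary.AllPairs using ([]; _∷_)
open import Data.List.Relation.Unary.Any using (here)
import Data.List.Relation.Unary.Unique.Propositional as List
open import Data.List.Relation.Unary.Unique.Propositional.Properties using (allFin⁺; cartesianProductWith⁺)
open import Data.Nat as ℕ using (ℕ; zero; suc; _≤_)
open import Data.Product using (∃-syntax; _×_; _,_; proj₁; proj₂; uncurry)
open import Data.Vec as Vec using (Vec; []; _∷_; lookup)
open import Data.Vec.Properties using (∷-injective)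
open import Data.Vec.Relation.Unary.AllPairs using (allPairs?)
open import Data.Vec.Relation.Unary.Unique.Propositional using (Unique)
open import Function using (_⇔_; mk⇔; Equivalence)
open import Level using (0ℓ)
open import Relation.Binary.PropositionalEquality using (_≡_; refl)
open import Relation.Nullary using (Dec; ¬_)
open import Relation.Nullary.Decidable using (map′; ¬?; _×-dec_; _→-dec_)
open import Relation.Unary using (Pred; Decidable)

private
  variable
    k n : ℕ

-- One-line notation, with positions and letters both taken from
-- {0,…,n-1} instead of {1,…,n}.
Word : ℕ → Set
Word n = Vec (Fin n) n

-- A repetition-free word of length n over n letters is a permutation.
IsPermutation : Pred (Word n) 0ℓ
IsPermutation = Unique

-- Position j immediately follows position i.
Adjacent : Fin n → Fin n → Set
Adjacent i j = toℕ j ≡ suc (toℕ i)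

Descent : Word n → Pred (Fin n) 0ℓ
Descent π i = ∃[ j ] Adjacent i j × lookup π j Fin.< lookup π i

OrderIsomorphic : Vec (Fin n) k → Vec ℕ k → Set
OrderIsomorphic u p = ∀ s t → (lookup u s Fin.< lookup u t) ⇔ (lookup p s ℕ.< lookup p t)

-- The vector a ∷ b ∷ c ∷ d ∷ [] encodes the vincular pattern abc-d in
-- which only a, b and c are underlined.
Pattern : Set
Pattern = Vec ℕ 4

Occurrence : Pattern → Word n → (i i′ i″ j : Fin n) → Set
Occurrence p π i i′ i″ j =
  Adjacent i i′ × Adjacent i′ i″ × i″ Fin.< j ×
  OrderIsomorphic (Vec.map (lookup π) (i ∷ i′ ∷ i″ ∷ j ∷ [])) p

Contains : Pattern → Pred (Word n) 0ℓ
Contains p π = ∃[ i ] ∃[ i′ ] ∃[ i″ ] ∃[ j ] Occurrence p π i i′ i″ j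

-- 𝔖ₙ(p)
Avoiding : Pattern → Pred (Word n) 0ℓ
Avoiding p π = IsPermutation π × ¬ Contains p π

isPermutation? : Decidable (IsPermutation {n})
isPermutation? = allPairs? λ x y → ¬? (x Fin.≟ y)

adjacent? : (i j : Fin n) → Dec (Adjacent i j)
adjacent? i j = toℕ j ℕ.≟ suc (toℕ i)

descent? : (π : Word n) → Decidable (Descent π)
descent? π i = Fin.any? λ j → adjacent? i j ×-dec (lookup π j Fin.<? lookup π i)

orderIsomorphic? : (u : Vec (Fin n) k) (p : Vec ℕ k) → Dec (OrderIsomorphic u p)
orderIsomorphic? u p = Fin.all? λ s → Fin.all? λ t →
  let u? = lookup u s Fin.<? lookup u t
      p? = lookup p s ℕ.<? lookup p t
  in map′ (uncurry mk⇔) (λ e → Equivalence.to e , Equivalence.from e)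
       ((u? →-dec p?) ×-dec (p? →-dec u?))

contains? : (p : Pattern) → Decidable (Contains {n} p)
contains? p π = Fin.any? λ i → Fin.any? λ i′ → Fin.any? λ i″ → Fin.any? λ j →
  adjacent? i i′ ×-dec adjacent? i′ i″ ×-dec (i″ Fin.<? j) ×-dec
  orderIsomorphic? (Vec.map (lookup π) (i ∷ i′ ∷ i″ ∷ j ∷ [])) p

avoiding? : (p : Pattern) → Decidable (Avoiding {n} p)
avoiding? p π = isPermutation? π ×-dec ¬? (contains? p π)

des : Word n → ℕ
des {n} π = length (filter (descent? π) (allFin n))

allVecs : ∀ n k → List (Vec (Fin n) k)
allVecs n zero    = [] List.∷ List.[]
allVecs n (suc k) = cartesianProductWith _∷_ (allFin n) (allVecs n k)

-- The two lemmas say that allVecs lists every vector exactly once, so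
-- that filtering it and taking the length computes a cardinality.
allVecs-complete : (v : Vec (Fin n) k) → v ∈ allVecs n k
allVecs-complete []      = here refl
allVecs-complete (x ∷ v) = ∈-cartesianProductWith⁺ _∷_ (∈-allFin x) (allVecs-complete v)

allVecs-unique : ∀ n k → List.Unique (allVecs n k)
allVecs-unique n zero    = [] ∷ []
allVecs-unique n (suc k) = cartesianProductWith⁺ _∷_ ∷-injective (allFin⁺ n) (allVecs-unique n k)

-- The cardinality of { π ∈ Word n ∣ P π }.
card : {P : Pred (Word n) 0ℓ} → Decidable P → ℕ
card {n} P? = length (filter P? (allVecs n n))

infix 4 _∼des_

_∼des_ : Pattern → Pattern → Set
p ∼des q = ∀ n m → 1 ≤ n →
  card {n} (λ π → avoiding? p π ×-dec (des π ℕ.≟ m)) ≡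
  card {n} (λ π → avoiding? q π ×-dec (des π ℕ.≟ m))

{-# OPTIONS --safe #-}
module Submission where

open import Data.Bool using (true; false; if_then_else_)
open import Data.Fin as Fin using (Fin; zero; suc; toℕ; #_)
import Data.Fin.Properties as Fin
open import Data.List as List using (List; []; _∷_; _++_; length; filter; allFin; cartesianProductWith)
open import Data.List.Properties using (length-++; length-tabulate; map-++; map-∘; map-cong; map-tabulate; ++-assoc; ++-identityʳ)
open import Data.List.Membership.Propositional using (_∈_)
open import Data.List.Relation.Binary.Permutation.Propositional using (_↭_; ↭-sym; ↭-trans; prep)
open import Data.List.Relation.Binary.Permutation.Propositional.Properties using (shift; All-resp-↭; ∈-resp-↭)
open import Data.List.Relation.Binary.Sublist.Propositional using (_⊆_; []; _∷_; _∷ʳ_; ⊆-refl)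
open import Data.List.Relation.Binary.Sublist.Propositional.Properties using (All-resp-⊆; ++⁺)
import Data.List.Relation.Unary.All as L
import Data.List.Relation.Unary.All.Properties as L
open import Data.List.Relation.Unary.AllPairs using (AllPairs; []; _∷_)
import Data.List.Relation.Unary.AllPairs.Properties as AllPairs
open import Data.List.Relation.Unary.Any using (here)
open import Data.List.Membership.Propositional.Properties using (∈-++⁺ʳ)
open import Data.Nat as ℕ using (ℕ; zero; suc; pred; _+_; z<s; s<s; s<s⁻¹)
open import Data.Nat.ListAction using (sum)
open import Data.Nat.ListAction.Properties using (sum-++)
open import Data.Nat.Properties using (+-assoc; +-identityʳ; suc-injective; +-suc; ≤ᵇ⇒≤)
open import Data.Nat.Solver using (module +-*-Solver)
open import Data.Product using (_×_; _,_; proj₂; ∃-syntax)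
open import Data.Unit using (⊤; tt)
open import Data.Vec as Vec using (Vec; []; _∷_; lookup; toList)
import Data.Vec.Relation.Unary.All as V
import Data.Vec.Relation.Unary.All.Properties as V
import Data.Vec.Relation.Unary.AllPairs as VP
open import Data.Vec.Properties using (lookup-map)
open import Data.Vec.Relation.Unary.Linked using (Linked; [-]; _∷_)
import Data.Vec.Relation.Unary.Linked.Properties as Linked
open import Function using (_∘_; _⇔_; mk⇔; Equivalence)
open import Relation.Binary.Definitions using (tri<; tri≈; tri>)
open import Relation.Binary.PropositionalEquality
open import Relation.Nullary using (Dec; yes; no; does; ¬_; contradiction)
open import Relation.Nullary.Decidable using (¬?; _×-dec_; _→-dec_; dec-true; dec-false; does-⇔)
open import Relation.Unary using (Decidable)

open import Defs

-- Read a permutation from left to right, remembering only how many unused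
-- letters lie below and above the last letter.  The number of completions after
-- an ascent x z depends on z, but its sum over z satisfies the same recursion for
-- both patterns.  With p unused letters below x and q above it, the only step in
-- which the patterns differ is x z y with x < y < z: for 132-4, z must be the
-- largest unused letter and y is any of the other q − 1 letters above x; for
-- 142-3, y is any of them but the largest and z is the next unused letter after y.
-- Both times the states left behind are (p + i, j) with i + j = q − 2, once each,
-- with the same number of descents.

open ≡-Reasoning

private
  variable
    k n : ℕ
    A : Set
    P Q : Set

-- Indicators and sums over the splittings of a list.

infixr 6 [_]·_

[_]·_ : Dec P → ℕ → ℕ
[ P? ]· m = if does P? then m else 0

[]·-yes : (P? : Dec P) → P → ∀ m → [ P? ]· m ≡ m
[]·-yes P? p m rewrite dec-true P? p = refl

[]·-no : (P? : Dec P) → ¬ P → ∀ m → [ P? ]· m ≡ 0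
[]·-no P? ¬p m rewrite dec-false P? ¬p = refl

[]·-⇔ : P ⇔ Q → (P? : Dec P) (Q? : Dec Q) → ∀ m → [ P? ]· m ≡ [ Q? ]· m
[]·-⇔ e P? Q? m = cong (if_then m else 0) (does-⇔ e P? Q?)

[]·-× : (P? : Dec P) (Q? : Dec Q) → ∀ m → [ P? ×-dec Q? ]· m ≡ [ P? ]· [ Q? ]· m
[]·-× P? Q? m with does P?
... | true  = refl
... | false = refl

-- The pairs are those with `i + j + 1 = m`: singling out one of `m` ordered letters leaves `i`
-- before it and `j` after it.
Σdiag : ℕ → (ℕ → ℕ → ℕ) → ℕ
Σdiag zero    f = 0
Σdiag (suc m) f = f 0 m + Σdiag m (λ i j → f (suc i) j)

Σdiag-cong : ∀ m {f g : ℕ → ℕ → ℕ} → (∀ i j → f i j ≡ g i j) → Σdiag m f ≡ Σdiag m g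
Σdiag-cong zero    f≡g = refl
Σdiag-cong (suc m) f≡g = cong₂ _+_ (f≡g 0 m) (Σdiag-cong m (λ i → f≡g (suc i)))

Σdiag-zero : ∀ m → Σdiag m (λ _ _ → 0) ≡ 0
Σdiag-zero zero    = refl
Σdiag-zero (suc m) = Σdiag-zero m

Σdiag-last : ∀ m f → Σdiag (suc m) f ≡ Σdiag m (λ i j → f i (suc j)) + f m 0
Σdiag-last zero    f = +-identityʳ (f 0 0)
Σdiag-last (suc m) f = trans
  (cong (f 0 (suc m) +_) (Σdiag-last m (λ i j → f (suc i) j)))
  (sym (+-assoc (f 0 (suc m)) _ _))

Σsplit : List A → (List A → A → List A → ℕ) → ℕ
Σsplit []      f = 0
Σsplit (x ∷ R) f = f [] x R + Σsplit R (λ L → f (x ∷ L))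

Σsplit-cong : (R : List A) {f g : List A → A → List A → ℕ} →
  (∀ L x U → R ≡ L ++ x ∷ U → f L x U ≡ g L x U) → Σsplit R f ≡ Σsplit R g
Σsplit-cong []      h = refl
Σsplit-cong (x ∷ R) h = cong₂ _+_ (h [] x R refl)
  (Σsplit-cong R (λ L y U e → h (x ∷ L) y U (cong (x ∷_) e)))

Σsplit-+ : (R : List A) (f g : List A → A → List A → ℕ) →
  Σsplit R (λ L x U → f L x U + g L x U) ≡ Σsplit R f + Σsplit R g
Σsplit-+ []      f g = refl
Σsplit-+ (x ∷ R) f g = trans
  (cong (f [] x R + g [] x R +_) (Σsplit-+ R (λ L → f (x ∷ L)) (λ L → g (x ∷ L))))
  (solve 4 (λ a b c d → a :+ b :+ (c :+ d) := a :+ c :+ (b :+ d)) refl (f [] x R) (g [] x R) _ _)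
  where open +-*-Solver

Σsplit-++ : (R S : List A) (f : List A → A → List A → ℕ) →
  Σsplit (R ++ S) f ≡
  Σsplit R (λ L x U → f L x (U ++ S)) + Σsplit S (λ L → f (R ++ L))
Σsplit-++ []      S f = refl
Σsplit-++ (x ∷ R) S f = trans
  (cong (f [] x (R ++ S) +_) (Σsplit-++ R S (λ L → f (x ∷ L))))
  (sym (+-assoc (f [] x (R ++ S)) _ _))

Σsplit-lengths : (R : List A) (F : ℕ → ℕ → ℕ) →
  Σsplit R (λ L _ U → F (length L) (length U)) ≡ Σdiag (length R) F
Σsplit-lengths []      F = refl
Σsplit-lengths (x ∷ R) F = cong (F 0 (length R) +_) (Σsplit-lengths R (λ i → F (suc i)))

Σsplit-diag : (R : List A) {f : List A → A → List A → ℕ} (F : ℕ → ℕ → ℕ) →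
  (∀ L x U → R ≡ L ++ x ∷ U → f L x U ≡ F (length L) (length U)) →
  Σsplit R f ≡ Σdiag (length R) F
Σsplit-diag R F h = trans (Σsplit-cong R h) (Σsplit-lengths R F)

Σsplit-sum : (R : List A) (f : A → ℕ) → sum (List.map f R) ≡ Σsplit R (λ _ x _ → f x)
Σsplit-sum []      f = refl
Σsplit-sum (x ∷ R) f = cong (f x +_) (Σsplit-sum R f)

-- The sum of f over the vectors that draw k letters from R without replacement.
Σarr : List A → ∀ k → (Vec A k → ℕ) → ℕ
Σarr R zero    f = f []
Σarr R (suc k) f = Σsplit R (λ L x U → Σarr (L ++ U) k (λ v → f (x ∷ v)))

length-delete : (L : List A) {x : A} {U : List A} →
  length (L ++ x ∷ U) ≡ suc k → length (L ++ U) ≡ k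
length-delete L {x} {U} e = suc-injective (begin
  suc (length (L ++ U))       ≡⟨ cong suc (length-++ L) ⟩
  suc (length L + length U)   ≡⟨ +-suc (length L) (length U) ⟨
  length L + suc (length U)   ≡⟨ length-++ L ⟨
  length (L ++ x ∷ U)         ≡⟨ e ⟩
  suc _                       ∎)

-- A vector that draws all of `R` is a rearrangement of `R`, so agreement on rearrangements
-- suffices. This lets a condition on all entries of `v` be decided from `R`.
Σarr-cong : ∀ k (R : List A) {f g : Vec A k → ℕ} → length R ≡ k →
  (∀ v → toList v ↭ R → f v ≡ g v) → Σarr R k f ≡ Σarr R k g
Σarr-cong zero    []  e h = h [] _↭_.refl
Σarr-cong (suc k) R   e h = Σsplit-cong R λ where
  L x U refl → Σarr-cong k (L ++ U) (length-delete L e)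
    (λ v v↭ → h (x ∷ v) (↭-trans (prep x v↭) (↭-sym (shift x L U))))

Σarr-zero : ∀ k (R : List A) → Σarr R k (λ _ → 0) ≡ 0
Σarr-zero zero    R = refl
Σarr-zero (suc k) R = trans
  (Σsplit-diag R (λ _ _ → 0) (λ L x U _ → Σarr-zero k (L ++ U)))
  (Σdiag-zero (length R))

-- From repetition-free words to arrangements of a sorted list.

Sorted : List (Fin n) → Set
Sorted = AllPairs Fin._<_

sorted-⊆ : {R S : List (Fin n)} → R ⊆ S → Sorted S → Sorted R
sorted-⊆ []         []         = []
sorted-⊆ (_ ∷ʳ τ)   (_ ∷ s)    = sorted-⊆ τ s
sorted-⊆ (refl ∷ τ) (x< ∷ s)   = All-resp-⊆ τ x< ∷ sorted-⊆ τ s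

sorted-before : ∀ (L : List (Fin n)) {x U} → Sorted (L ++ x ∷ U) → L.All (Fin._< x) L
sorted-before []      s        = L.[]
sorted-before (y ∷ L) (y< ∷ s) = L.head (L.++⁻ʳ L y<) L.∷ sorted-before L s

sorted-after : ∀ (L : List (Fin n)) {x U} → Sorted (L ++ x ∷ U) → L.All (x Fin.<_) U
sorted-after []      (x< ∷ _) = x<
sorted-after (y ∷ L) (_ ∷ s)  = sorted-after L s

Σword : List A → ∀ k → (Vec A k → ℕ) → ℕ
Σword R zero    f = f []
Σword R (suc k) f = sum (List.map (λ x → Σword R k (λ v → f (x ∷ v))) R)

Σword-cong : ∀ k (R : List A) {f g : Vec A k → ℕ} → (∀ v → f v ≡ g v) → Σword R k f ≡ Σword R k g
Σword-cong zero    R h = h []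
Σword-cong (suc k) R h = cong sum (map-cong (λ x → Σword-cong k R (λ v → h (x ∷ v))) R)

Σword-zero : ∀ k (R : List A) → Σword R k (λ _ → 0) ≡ 0
Σword-zero zero    R = refl
Σword-zero (suc k) R = trans (cong sum (map-cong (λ _ → Σword-zero k R) R)) (zeros R)
  where
  zeros : (R : List A) → sum (List.map (λ _ → 0) R) ≡ 0
  zeros []      = refl
  zeros (_ ∷ R) = zeros R

sum-delete : ∀ (L : List A) {x U} {f g : A → ℕ} → f x ≡ 0 → L.All (λ y → f y ≡ g y) (L ++ U) →
  sum (List.map f (L ++ x ∷ U)) ≡ sum (List.map g (L ++ U))
sum-delete []      {U = U} fx≡0 h rewrite fx≡0 = eq U h
  where
  eq : ∀ U {f g : A → ℕ} → L.All (λ y → f y ≡ g y) U → sum (List.map f U) ≡ sum (List.map g U)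
  eq []      L.[]      = refl
  eq (_ ∷ U) (e L.∷ h) = cong₂ _+_ e (eq U h)
sum-delete (y ∷ L) fx≡0 (e L.∷ h) = cong₂ _+_ e (sum-delete L fx≡0 h)

≢? : (x y : Fin n) → Dec (x ≢ y)
≢? x y = ¬? (x Fin.≟ y)

-- If the first letter is `x`, the indicator vanishes and that summand drops out; any other first
-- letter passes the condition on to the tail.
Σword-delete : ∀ k (L : List (Fin n)) {x U} (f : Vec (Fin n) k → ℕ) → L.All (x ≢_) (L ++ U) →
  Σword (L ++ x ∷ U) k (λ v → [ V.all? (≢? x) v ]· f v) ≡ Σword (L ++ U) k f
Σword-delete zero    L f x∉ = refl
Σword-delete (suc k) L {x} {U} f x∉ = sum-delete L
  (trans (Σword-cong k (L ++ x ∷ U) (λ v → []·-no (V.all? (≢? x) (x ∷ v)) (λ a → V.head a refl) _))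
         (Σword-zero k (L ++ x ∷ U)))
  (L.map (λ {y} x≢y → trans
    (Σword-cong k (L ++ x ∷ U) (λ v →
      []·-⇔ (mk⇔ V.tail (x≢y V.∷_)) (V.all? (≢? x) (y ∷ v)) (V.all? (≢? x) v) _))
    (Σword-delete k L (λ v → f (y ∷ v)) x∉)) x∉)

-- Uniqueness of `x ∷ v` splits into absence of `x` from `v`, which deletes `x` from the alphabet,
-- and uniqueness of `v`. Sortedness ensures that the remaining letters differ from `x`.
Σword-unique : ∀ k (R : List (Fin n)) (f : Vec (Fin n) k → ℕ) → Sorted R →
  Σword R k (λ v → [ VP.allPairs? ≢? v ]· f v) ≡ Σarr R k f
Σword-unique zero    R f s = refl
Σword-unique (suc k) R f s = trans (Σsplit-sum R _) (Σsplit-cong R λ where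
  L x U refl → begin
    Σword R k (λ v → [ VP.allPairs? ≢? (x ∷ v) ]· f (x ∷ v))
      ≡⟨ Σword-cong k R (λ v → trans
           ([]·-⇔ (mk⇔ VP.uncons (λ (a , b) → a VP.∷ b))
             (VP.allPairs? ≢? (x ∷ v)) (V.all? (≢? x) v ×-dec VP.allPairs? ≢? v) (f (x ∷ v)))
           ([]·-× (V.all? (≢? x) v) (VP.allPairs? ≢? v) (f (x ∷ v)))) ⟩
    Σword R k (λ v → [ V.all? (≢? x) v ]· [ VP.allPairs? ≢? v ]· f (x ∷ v))
      ≡⟨ Σword-delete k L (λ v → [ VP.allPairs? ≢? v ]· f (x ∷ v))
           (L.++⁺ (L.map (λ y<x → ≢-sym (Fin.<⇒≢ y<x)) (sorted-before L s))
                  (L.map Fin.<⇒≢ (sorted-after L s))) ⟩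
    Σword (L ++ U) k (λ v → [ VP.allPairs? ≢? v ]· f (x ∷ v))
      ≡⟨ Σword-unique k (L ++ U) (λ v → f (x ∷ v))
           (sorted-⊆ (++⁺ (⊆-refl {x = L}) (x ∷ʳ ⊆-refl)) s) ⟩
    Σarr (L ++ U) k (λ v → f (x ∷ v)) ∎)

sum-cartesianProductWith : {B C : Set} (g : A → B → C) (f : C → ℕ) (xs : List A) (ys : List B) →
  sum (List.map f (cartesianProductWith g xs ys)) ≡
  sum (List.map (λ x → sum (List.map (λ y → f (g x y)) ys)) xs)
sum-cartesianProductWith g f []       ys = refl
sum-cartesianProductWith g f (x ∷ xs) ys = begin
  sum (List.map f (List.map (g x) ys ++ cartesianProductWith g xs ys))
    ≡⟨ cong sum (map-++ f (List.map (g x) ys) _) ⟩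
  sum (List.map f (List.map (g x) ys) ++ List.map f (cartesianProductWith g xs ys))
    ≡⟨ sum-++ (List.map f (List.map (g x) ys)) _ ⟩
  sum (List.map f (List.map (g x) ys)) + sum (List.map f (cartesianProductWith g xs ys))
    ≡⟨ cong₂ _+_ (cong sum (sym (map-∘ ys))) (sum-cartesianProductWith g f xs ys) ⟩
  _ ∎

sum-allVecs : ∀ n k (f : Vec (Fin n) k → ℕ) →
  sum (List.map f (allVecs n k)) ≡ Σword (allFin n) k f
sum-allVecs n zero    f = +-identityʳ (f [])
sum-allVecs n (suc k) f = trans
  (sum-cartesianProductWith Vec._∷_ f (allFin n) (allVecs n k))
  (cong sum (map-cong (λ x → sum-allVecs n k (λ v → f (x ∷ v))) (allFin n)))

length-filter-sum : {A : Set} {P : A → Set} (P? : Decidable P) (xs : List A) →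
  length (filter P? xs) ≡ sum (List.map (λ x → [ P? x ]· 1) xs)
length-filter-sum P? []       = refl
length-filter-sum P? (x ∷ xs) with does (P? x)
... | true  = cong suc (length-filter-sum P? xs)
... | false = length-filter-sum P? xs

Σarr-≗ : ∀ k (R : List A) {f g : Vec A k → ℕ} → (∀ v → f v ≡ g v) → Σarr R k f ≡ Σarr R k g
Σarr-≗ zero    R h = h []
Σarr-≗ (suc k) R h = Σsplit-cong R (λ L x U _ → Σarr-≗ k (L ++ U) (λ v → h (x ∷ v)))

-- Descents and a recursion common to both patterns.

descents : Vec (Fin n) k → ℕ
descents []          = 0
descents (x ∷ [])    = 0
descents (x ∷ y ∷ v) = ([ y Fin.<? x ]· 1) + descents (y ∷ v)

descents-desc : ∀ {x y} (v : Vec (Fin n) k) → y Fin.< x →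
  descents (x ∷ y ∷ v) ≡ suc (descents (y ∷ v))
descents-desc {x = x} {y} v y<x = cong (_+ descents (y ∷ v)) ([]·-yes (y Fin.<? x) y<x 1)

descents-asc : ∀ {x y} (v : Vec (Fin n) k) → x Fin.< y →
  descents (x ∷ y ∷ v) ≡ descents (y ∷ v)
descents-asc {x = x} {y} v x<y =
  cong (_+ descents (y ∷ v)) ([]·-no (y Fin.<? x) (λ y<x → Fin.<-asym x<y y<x) 1)

-- In both counts, p and q are the numbers of unused letters below and above
-- the last letter, and a word with d descents has weight g d.  afterLetter
-- completes by k letters; afterAscent completes by an ascent and k letters.
mutual
  afterLetter : (k p q : ℕ) → (ℕ → ℕ) → ℕ
  afterLetter zero    p q g = g 0
  afterLetter (suc k) p q g =
    Σdiag p (λ i j → afterLetter k i (j + q) (g ∘ suc)) + afterAscent k p q g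

  afterAscent : (k p q : ℕ) → (ℕ → ℕ) → ℕ
  afterAscent zero    p q g = Σdiag q (λ _ _ → g 0)
  afterAscent (suc k) p q g =
    Σdiag q (λ b c → Σdiag p (λ i j → afterLetter k i (j + b + c) (g ∘ suc))
                     + afterAscent k (p + b) c g)
    + Σdiag (pred q) (λ i j → afterLetter k (p + i) j (g ∘ suc))

-- No pattern enters this number, so the equivalence follows once both counts are shown to equal it.
totalWeight : ℕ → (ℕ → ℕ) → ℕ
totalWeight zero    g = g 0
totalWeight (suc m) g = Σdiag (suc m) (λ i j → afterLetter m i j g)

-- Words restricted by a blocking relation, counted by ranks.

-- B z y d says that d may not occur after consecutive letters x z y with x < y < z.
module Blocking {n : ℕ} (B : Fin n → Fin n → Fin n → Set) (B? : ∀ z y → Decidable (B z y)) where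

  unblocked? : ∀ z y (v : Vec (Fin n) k) → Dec (V.All (λ d → ¬ B z y d) v)
  unblocked? z y = V.all? (λ d → ¬? (B? z y d))

  -- Concerns only the occurrences that begin at `x`, so that `Allowed` decomposes along the word.
  StartAllowed : Fin n → Vec (Fin n) k → Set
  StartAllowed x []          = ⊤
  StartAllowed x (z ∷ [])    = ⊤
  StartAllowed x (z ∷ y ∷ v) = x Fin.< y → y Fin.< z → V.All (λ d → ¬ B z y d) v

  startAllowed? : ∀ x (v : Vec (Fin n) k) → Dec (StartAllowed x v)
  startAllowed? x []          = yes tt
  startAllowed? x (z ∷ [])    = yes tt
  startAllowed? x (z ∷ y ∷ v) = (x Fin.<? y) →-dec (y Fin.<? z) →-dec unblocked? z y v

  Allowed : Vec (Fin n) k → Set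
  Allowed []      = ⊤
  Allowed (x ∷ v) = StartAllowed x v × Allowed v

  allowed? : (v : Vec (Fin n) k) → Dec (Allowed v)
  allowed? []      = yes tt
  allowed? (x ∷ v) = startAllowed? x v ×-dec allowed? v

  weight : (ℕ → ℕ) → Vec (Fin n) k → ℕ
  weight g v = [ allowed? v ]· g (descents v)

  -- An occurrence beginning at `x` needs an ascent there, so `x` imposes nothing; its descent is
  -- absorbed into `g ∘ suc`.
  weight-desc : ∀ g {x y} (v : Vec (Fin n) k) → y Fin.< x →
    weight g (x ∷ y ∷ v) ≡ weight (g ∘ suc) (y ∷ v)
  weight-desc g {x} {y} v y<x = trans
    (cong (λ d → [ allowed? (x ∷ y ∷ v) ]· g d) (descents-desc v y<x))
    ([]·-⇔ (mk⇔ proj₂ (start v ,_)) (allowed? (x ∷ y ∷ v)) (allowed? (y ∷ v)) _)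
    where
    start : ∀ {k} (v : Vec (Fin n) k) → StartAllowed x (y ∷ v)
    start []      = tt
    start (w ∷ v) x<w w<y = contradiction y<x (Fin.<-asym (Fin.<-trans x<w w<y))

  weight-asc : ∀ g {x z} (v : Vec (Fin n) k) → x Fin.< z → StartAllowed x (z ∷ v) →
    weight g (x ∷ z ∷ v) ≡ weight g (z ∷ v)
  weight-asc g {x} {z} v x<z a = trans
    (cong (λ d → [ allowed? (x ∷ z ∷ v) ]· g d) (descents-asc v x<z))
    ([]·-⇔ (mk⇔ proj₂ (a ,_)) (allowed? (x ∷ z ∷ v)) (allowed? (z ∷ v)) _)

  -- Once `x < y < z` is known, the condition at `x` mentions only `z`, `y` and `v`. The descent
  -- from `z` to `y` then removes `z`, which survives only in the `unblocked?` factor.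
  weight-peak : ∀ g {x z y} (v : Vec (Fin n) k) → x Fin.< y → y Fin.< z →
    weight g (x ∷ z ∷ y ∷ v) ≡ [ unblocked? z y v ]· weight (g ∘ suc) (y ∷ v)
  weight-peak g {x} {z} {y} v x<y y<z = begin
    weight g (x ∷ z ∷ y ∷ v)
      ≡⟨ cong (λ d → [ allowed? (x ∷ z ∷ y ∷ v) ]· g d) (descents-asc (y ∷ v) (Fin.<-trans x<y y<z)) ⟩
    [ startAllowed? x (z ∷ y ∷ v) ×-dec allowed? (z ∷ y ∷ v) ]· g (descents (z ∷ y ∷ v))
      ≡⟨ []·-× (startAllowed? x (z ∷ y ∷ v)) (allowed? (z ∷ y ∷ v)) _ ⟩
    [ startAllowed? x (z ∷ y ∷ v) ]· weight g (z ∷ y ∷ v)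
      ≡⟨ []·-⇔ (mk⇔ (λ s → s x<y y<z) (λ u _ _ → u)) (startAllowed? x (z ∷ y ∷ v)) (unblocked? z y v) _ ⟩
    [ unblocked? z y v ]· weight g (z ∷ y ∷ v)
      ≡⟨ cong ([ unblocked? z y v ]·_) (weight-desc g v y<z) ⟩
    [ unblocked? z y v ]· weight (g ∘ suc) (y ∷ v) ∎

  -- A continuation uses every letter of `R`, so whether a peak is harmful depends on `R` alone:
  -- either all continuations count or, as in `Σarr-blocked`, none does.
  Σarr-unblocked : ∀ k (R : List (Fin n)) z y (f : Vec (Fin n) k → ℕ) → length R ≡ k →
    L.All (λ d → ¬ B z y d) R →
    Σarr R k (λ v → [ unblocked? z y v ]· f v) ≡ Σarr R k f
  Σarr-unblocked k R z y f e ¬b = Σarr-cong k R e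
    (λ v v↭ → []·-yes (unblocked? z y v) (V.toList⁻ (All-resp-↭ (↭-sym v↭) ¬b)) (f v))

  Σarr-blocked : ∀ k (R : List (Fin n)) z y (f : Vec (Fin n) k → ℕ) → length R ≡ k →
    ∀ {d} → d ∈ R → B z y d →
    Σarr R k (λ v → [ unblocked? z y v ]· f v) ≡ 0
  Σarr-blocked k R z y f e d∈R b = trans
    (Σarr-cong k R e (λ v v↭ → []·-no (unblocked? z y v)
      (λ u → L.lookup (V.toList⁺ u) (∈-resp-↭ (↭-sym v↭) d∈R) b) (f v)))
    (Σarr-zero k R)

  -- The only way a blocking relation enters the count: the total weight of the
  -- continuations x z y ... with x < y < z, where z and y run through U.
  PeakSum : Set
  PeakSum = ∀ {k} (f : Fin n → Vec (Fin n) k → ℕ) (h : ℕ → ℕ → ℕ) L U →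
    Sorted (L ++ U) → length L + length U ≡ suc (suc k) →
    (∀ R y S → Sorted (R ++ y ∷ S) → length R + length S ≡ k →
      Σarr (R ++ S) k (f y) ≡ h (length R) (length S)) →
    Σsplit U (λ U₁ z U₂ → Σsplit U₁ (λ V₁ y V₂ →
      Σarr ((L ++ V₁) ++ (V₂ ++ U₂)) k (λ v → [ unblocked? z y v ]· f y v)))
    ≡ Σdiag (pred (length U)) (λ i j → h (length L + i) j)

  module _ (peakSum : PeakSum) where
    mutual
      -- The next letter comes from `L`, making a descent, or from `U`, making an ascent.
      Σ-afterLetter : ∀ k g x L U → Sorted (L ++ x ∷ U) → length L + length U ≡ k →
        Σarr (L ++ U) k (λ v → weight g (x ∷ v)) ≡ afterLetter k (length L) (length U) g
      Σ-afterLetter zero    g x L U s e = refl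
      Σ-afterLetter (suc k) g x L U s e = trans (Σsplit-++ L U _) (cong₂ _+_
        (Σsplit-descents k g L U _
          (L.map (λ y<x v → weight-desc g v y<x) (sorted-before L s))
          (sorted-⊆ (++⁺ (⊆-refl {x = L}) (x ∷ʳ ⊆-refl)) s) e)
        (Σ-afterAscent k g x L U s e))

      -- The letter `y` after `x z` lies below `x`, above `z` or between them. The first two cases
      -- depend only on the rank of `z` and form `smooth`; the third depends on the pattern, and
      -- only its sum over all `z` is known, through `peakSum`.
      Σ-afterAscent : ∀ k g x L U → Sorted (L ++ x ∷ U) → length L + length U ≡ suc k →
        Σsplit U (λ U₁ z U₂ → Σarr ((L ++ U₁) ++ U₂) k (λ v → weight g (x ∷ z ∷ v)))
        ≡ afterAscent k (length L) (length U) g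
      Σ-afterAscent zero g x L U s e = Σsplit-diag U (λ _ _ → g 0) λ where
        U₁ z U₂ refl →
          let x<z = L.head (L.++⁻ʳ U₁ (sorted-after L s))
          in weight-asc g [] x<z tt
      Σ-afterAscent (suc k) g x L U s e = begin
        Σsplit U (λ U₁ z U₂ → Σarr ((L ++ U₁) ++ U₂) (suc k) (λ v → weight g (x ∷ z ∷ v)))
          ≡⟨ Σsplit-cong U step ⟩
        Σsplit U (λ U₁ z U₂ → smooth (length U₁) (length U₂) + peak U₁ z U₂)
          ≡⟨ Σsplit-+ U _ _ ⟩
        Σsplit U (λ U₁ z U₂ → smooth (length U₁) (length U₂)) + Σsplit U peak
          ≡⟨ cong₂ _+_ (Σsplit-lengths U smooth)
               -- The rank formula that `peakSum` asks of `f` is the induction hypothesis: with `z`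
               -- and `y` placed, `k` letters remain.
               (peakSum (λ y v → weight (g ∘ suc) (y ∷ v)) (λ i j → afterLetter k i j (g ∘ suc)) L U
                 (sorted-⊆ (++⁺ (⊆-refl {x = L}) (x ∷ʳ ⊆-refl)) s) e
                 (λ R y S → Σ-afterLetter k (g ∘ suc) y R S)) ⟩
        afterAscent (suc k) (length L) (length U) g ∎
        where
        smooth : ℕ → ℕ → ℕ
        smooth b c = Σdiag (length L) (λ i j → afterLetter k i (j + b + c) (g ∘ suc))
                     + afterAscent k (length L + b) c g

        peak : List (Fin n) → Fin n → List (Fin n) → ℕ
        peak U₁ z U₂ = Σsplit U₁ (λ V₁ y V₂ → Σarr ((L ++ V₁) ++ (V₂ ++ U₂)) k
          (λ v → [ unblocked? z y v ]· weight (g ∘ suc) (y ∷ v)))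

        step : ∀ U₁ z U₂ → U ≡ U₁ ++ z ∷ U₂ →
          Σarr ((L ++ U₁) ++ U₂) (suc k) (λ v → weight g (x ∷ z ∷ v))
          ≡ smooth (length U₁) (length U₂) + peak U₁ z U₂
        step U₁ z U₂ refl = begin
          Σsplit ((L ++ U₁) ++ U₂) F
            ≡⟨ Σsplit-++ (L ++ U₁) U₂ F ⟩
          Σsplit (L ++ U₁) (λ R y S → F R y (S ++ U₂)) + Σsplit U₂ (λ R → F ((L ++ U₁) ++ R))
            ≡⟨ cong₂ _+_ (Σsplit-++ L U₁ _) above ⟩
          Σsplit L (λ R y S → F R y ((S ++ U₁) ++ U₂))
            + Σsplit U₁ (λ R y S → F (L ++ R) y (S ++ U₂))
            + afterAscent k (length L + length U₁) (length U₂) g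
            ≡⟨ cong (_+ afterAscent k (length L + length U₁) (length U₂) g) (cong₂ _+_ below between) ⟩
          Σdiag (length L) (λ i j → afterLetter k i (j + length U₁ + length U₂) (g ∘ suc))
            + peak U₁ z U₂
            + afterAscent k (length L + length U₁) (length U₂) g
            ≡⟨ solve 3 (λ a b c → a :+ b :+ c := a :+ c :+ b) refl
                 (Σdiag (length L) _) (peak U₁ z U₂) _ ⟩
          smooth (length U₁) (length U₂) + peak U₁ z U₂ ∎
          where
          open +-*-Solver

          F : List (Fin n) → Fin n → List (Fin n) → ℕ
          F R y S = Σarr (R ++ S) k (λ v → weight g (x ∷ z ∷ y ∷ v))

          x<U : L.All (x Fin.<_) (U₁ ++ z ∷ U₂)
          x<U = sorted-after L s

          x<z : x Fin.< z
          x<z = L.head (L.++⁻ʳ U₁ x<U)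

          s′ : Sorted ((L ++ U₁) ++ z ∷ U₂)
          s′ = subst Sorted (sym (++-assoc L U₁ (z ∷ U₂)))
            (sorted-⊆ (++⁺ (⊆-refl {x = L}) (x ∷ʳ ⊆-refl)) s)

          size : length L + length (U₁ ++ U₂) ≡ suc k
          size = suc-injective (begin
            suc (length L + length (U₁ ++ U₂))
              ≡⟨ cong (λ m → suc (length L + m)) (length-++ U₁) ⟩
            suc (length L + (length U₁ + length U₂))
              ≡⟨ solve 3 (λ p b c → con 1 :+ (p :+ (b :+ c)) := p :+ (b :+ (con 1 :+ c)))
                   refl (length L) (length U₁) (length U₂) ⟩
            length L + (length U₁ + suc (length U₂))
              ≡⟨ cong (length L +_) (length-++ U₁) ⟨
            length L + length (U₁ ++ z ∷ U₂)
              ≡⟨ e ⟩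
            suc (suc k) ∎)

          below : Σsplit L (λ R y S → F R y ((S ++ U₁) ++ U₂))
            ≡ Σdiag (length L) (λ i j → afterLetter k i (j + length U₁ + length U₂) (g ∘ suc))
          below = begin
            Σsplit L (λ R y S → F R y ((S ++ U₁) ++ U₂))
              ≡⟨ Σsplit-cong L (λ R y S _ → cong (λ T → F R y T) (++-assoc S U₁ U₂)) ⟩
            Σsplit L (λ R y S → F R y (S ++ (U₁ ++ U₂)))
              ≡⟨ Σsplit-descents k g L (U₁ ++ U₂) _
                   (L.map (λ {y} y<x v → trans
                       (weight-asc g (y ∷ v) x<z (λ x<y _ → contradiction x<y (Fin.<-asym y<x)))
                       (weight-desc g v (Fin.<-trans y<x x<z)))
                     (sorted-before L s))
                   (sorted-⊆ (++⁺ (⊆-refl {x = L}) (x ∷ʳ ++⁺ (⊆-refl {x = U₁}) (z ∷ʳ ⊆-refl))) s)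
                   size ⟩
            Σdiag (length L) (λ i j → afterLetter k i (j + length (U₁ ++ U₂)) (g ∘ suc))
              ≡⟨ Σdiag-cong (length L) (λ i j → cong (λ m → afterLetter k i m (g ∘ suc))
                   (trans (cong (j +_) (length-++ U₁)) (sym (+-assoc j _ _)))) ⟩
            _ ∎

          between : Σsplit U₁ (λ R y S → F (L ++ R) y (S ++ U₂)) ≡ peak U₁ z U₂
          between = Σsplit-cong U₁ λ where
            V₁ y V₂ refl → Σarr-≗ k ((L ++ V₁) ++ (V₂ ++ U₂)) (λ v → weight-peak g v
              (L.head (L.++⁻ʳ V₁ (L.++⁻ˡ (V₁ ++ y ∷ V₂) x<U)))
              (L.head (L.++⁻ʳ V₁ (L.++⁻ʳ L (sorted-before (L ++ U₁) s′)))))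

          -- Since `z < y`, no occurrence begins at `x`. What is left is an ascent from `z`, with
          -- `L ++ U₁` now below.
          above : Σsplit U₂ (λ R → F ((L ++ U₁) ++ R))
            ≡ afterAscent k (length L + length U₁) (length U₂) g
          above = begin
            Σsplit U₂ (λ R → F ((L ++ U₁) ++ R))
              ≡⟨ Σsplit-cong U₂ (λ where
                   V₁ y V₂ refl → Σarr-≗ k (((L ++ U₁) ++ V₁) ++ V₂) (λ v →
                     weight-asc g (y ∷ v) x<z (λ _ y<z → contradiction y<z
                       (Fin.<-asym (L.head (L.++⁻ʳ V₁ (sorted-after (L ++ U₁) s′))))))) ⟩
            Σsplit U₂ (λ V₁ y V₂ → Σarr (((L ++ U₁) ++ V₁) ++ V₂) k (λ v → weight g (z ∷ y ∷ v)))
              ≡⟨ Σ-afterAscent k g z (L ++ U₁) U₂ s′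
                   (trans (cong (_+ length U₂) (length-++ L))
                     (trans (+-assoc (length L) _ _)
                       (trans (cong (length L +_) (sym (length-++ U₁))) size))) ⟩
            afterAscent k (length (L ++ U₁)) (length U₂) g
              ≡⟨ cong (λ m → afterAscent k m (length U₂) g) (length-++ L) ⟩
            afterAscent k (length L + length U₁) (length U₂) g ∎

      -- Serves two cases, a descent from `x` itself and a descent from `z` to below `x`; each makes
      -- one descent, and `f` abstracts from the letters before `y`.
      Σsplit-descents : ∀ k g L U (f : Fin n → Vec (Fin n) k → ℕ) →
        L.All (λ y → ∀ v → f y v ≡ weight (g ∘ suc) (y ∷ v)) L →
        Sorted (L ++ U) → length L + length U ≡ suc k →
        Σsplit L (λ L₁ y L₂ → Σarr (L₁ ++ (L₂ ++ U)) k (f y))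
        ≡ Σdiag (length L) (λ i j → afterLetter k i (j + length U) (g ∘ suc))
      Σsplit-descents k g L U f h s e = Σsplit-diag L (λ i j → afterLetter k i (j + length U) (g ∘ suc)) λ where
          L₁ y L₂ refl → begin
            Σarr (L₁ ++ (L₂ ++ U)) k (f y)
              ≡⟨ Σarr-≗ k (L₁ ++ (L₂ ++ U)) (L.head (L.++⁻ʳ L₁ h)) ⟩
            Σarr (L₁ ++ (L₂ ++ U)) k (λ v → weight (g ∘ suc) (y ∷ v))
              ≡⟨ Σ-afterLetter k (g ∘ suc) y L₁ (L₂ ++ U)
                   (subst Sorted (++-assoc L₁ (y ∷ L₂) U) s)
                   (suc-injective (begin
                     suc (length L₁ + length (L₂ ++ U))
                       ≡⟨ cong (λ m → suc (length L₁ + m)) (length-++ L₂) ⟩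
                     suc (length L₁ + (length L₂ + length U))
                       ≡⟨ solve 3 (λ a b c → con 1 :+ (a :+ (b :+ c)) := a :+ (con 1 :+ b) :+ c)
                            refl (length L₁) (length L₂) (length U) ⟩
                     length L₁ + suc (length L₂) + length U
                       ≡⟨ cong (_+ length U) (length-++ L₁) ⟨
                     length (L₁ ++ y ∷ L₂) + length U
                       ≡⟨ e ⟩
                     suc k ∎)) ⟩
            afterLetter k (length L₁) (length (L₂ ++ U)) (g ∘ suc)
              ≡⟨ cong (λ m → afterLetter k (length L₁) m (g ∘ suc)) (length-++ L₂) ⟩
            afterLetter k (length L₁) (length L₂ + length U) (g ∘ suc) ∎
        where open +-*-Solver

    Σ-weight : ∀ m g (R : List (Fin n)) → Sorted R → length R ≡ m →
      Σarr R m (weight g) ≡ totalWeight m g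
    Σ-weight zero    g R s e = refl
    Σ-weight (suc m) g R s e = trans
      (Σsplit-diag R (λ i j → afterLetter m i j g) λ where
        L x U refl → Σ-afterLetter m g x L U s
          (trans (sym (length-++ L)) (length-delete L e)))
      (cong (λ r → Σdiag r (λ i j → afterLetter m i j g)) e)

-- The peak sums of the two patterns.

module _ {n : ℕ} (L V₁ : List (Fin n)) {y : Fin n} (V₂ : List (Fin n)) {z : Fin n} (U₂ : List (Fin n)) where

  -- The letters stand in the order `L`, `V₁`, `y`, `V₂`, `z`, `U₂`. The three versions expose `z`,
  -- expose `y`, and expose `y` with `z` deleted.
  peak-sorted₁ : Sorted (L ++ ((V₁ ++ y ∷ V₂) ++ z ∷ U₂)) → Sorted ((L ++ (V₁ ++ y ∷ V₂)) ++ z ∷ U₂)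
  peak-sorted₁ = subst Sorted (sym (++-assoc L (V₁ ++ y ∷ V₂) (z ∷ U₂)))

  peak-sorted₂ : Sorted (L ++ ((V₁ ++ y ∷ V₂) ++ z ∷ U₂)) → Sorted ((L ++ V₁) ++ y ∷ (V₂ ++ z ∷ U₂))
  peak-sorted₂ = subst Sorted (trans
    (cong (L ++_) (++-assoc V₁ (y ∷ V₂) (z ∷ U₂)))
    (sym (++-assoc L V₁ (y ∷ (V₂ ++ z ∷ U₂)))))

  peak-sorted₃ : Sorted (L ++ ((V₁ ++ y ∷ V₂) ++ z ∷ U₂)) → Sorted ((L ++ V₁) ++ y ∷ (V₂ ++ U₂))
  peak-sorted₃ s = sorted-⊆
    (++⁺ (⊆-refl {x = L ++ V₁}) (refl ∷ ++⁺ (⊆-refl {x = V₂}) (z ∷ʳ ⊆-refl))) (peak-sorted₂ s)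

  peak-length : length L + length ((V₁ ++ y ∷ V₂) ++ z ∷ U₂) ≡ suc (suc k) →
    length (L ++ V₁) + length (V₂ ++ U₂) ≡ k
  peak-length e = suc-injective (suc-injective (begin
    suc (suc (length (L ++ V₁) + length (V₂ ++ U₂)))
      ≡⟨ cong (λ m → suc (suc m)) (cong₂ _+_ (length-++ L) (length-++ V₂)) ⟩
    suc (suc (length L + length V₁ + (length V₂ + length U₂)))
      ≡⟨ solve 4 (λ a b c d → con 2 :+ (a :+ b :+ (c :+ d))
                           := a :+ (b :+ (con 1 :+ c) :+ (con 1 :+ d)))
           refl (length L) (length V₁) (length V₂) (length U₂) ⟩
    length L + (length V₁ + suc (length V₂) + suc (length U₂))
      ≡⟨ cong (λ m → length L + (m + suc (length U₂))) (length-++ V₁) ⟨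
    length L + (length (V₁ ++ y ∷ V₂) + suc (length U₂))
      ≡⟨ cong (length L +_) (length-++ (V₁ ++ y ∷ V₂)) ⟨
    length L + length ((V₁ ++ y ∷ V₂) ++ z ∷ U₂)
      ≡⟨ e ⟩
    suc (suc _) ∎))
    where open +-*-Solver

module Blocking-132-4 {n : ℕ} where
  Blocks : (z y d : Fin n) → Set
  Blocks z y d = z Fin.< d

  blocks? : ∀ z y → Decidable (Blocks z y)
  blocks? z y d = z Fin.<? d

  open Blocking Blocks blocks?

  -- A peak is allowed only for z = max U, and then y is an arbitrary smaller letter of U.
  peakSum : PeakSum
  peakSum {k} f h L U s e H = trans (Σsplit-diag U t inner) (Σdiag-t (length U))
    where
    h′ : ℕ → ℕ → ℕ
    h′ i j = h (length L + i) j

    t : ℕ → ℕ → ℕ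
    t b zero    = Σdiag b h′
    t b (suc c) = 0

    -- Only the term with `c = 0` survives; its `b` is one less than the number of letters of `U`,
    -- which gives the `pred`.
    Σdiag-t : ∀ m → Σdiag m t ≡ Σdiag (pred m) h′
    Σdiag-t zero    = refl
    Σdiag-t (suc m) = trans (Σdiag-last m t) (cong (_+ Σdiag m h′) (Σdiag-zero m))

    inner : ∀ U₁ z U₂ → U ≡ U₁ ++ z ∷ U₂ →
      Σsplit U₁ (λ V₁ y V₂ →
        Σarr ((L ++ V₁) ++ (V₂ ++ U₂)) k (λ v → [ unblocked? z y v ]· f y v))
      ≡ t (length U₁) (length U₂)
    inner U₁ z [] refl = Σsplit-diag U₁ h′ λ where
      V₁ y V₂ refl →
        let R = (L ++ V₁) ++ (V₂ ++ [])
            size = peak-length L V₁ V₂ [] e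
            L++U₁<z = sorted-before (L ++ (V₁ ++ y ∷ V₂)) (peak-sorted₁ L V₁ V₂ [] s)
            U₁<z = L.++⁻ʳ L L++U₁<z
            R<z = L.++⁺ (L.++⁺ (L.++⁻ˡ L L++U₁<z) (L.++⁻ˡ V₁ U₁<z))
                        (L.++⁺ (L.tail (L.++⁻ʳ V₁ U₁<z)) L.[])
        in begin
          Σarr R k (λ v → [ unblocked? z y v ]· f y v)
            ≡⟨ Σarr-unblocked k R z y (f y) (trans (length-++ (L ++ V₁)) size)
                 (L.map Fin.<-asym R<z) ⟩
          Σarr R k (f y)
            ≡⟨ H (L ++ V₁) y (V₂ ++ []) (peak-sorted₃ L V₁ V₂ [] s) size ⟩
          h (length (L ++ V₁)) (length (V₂ ++ []))
            ≡⟨ cong₂ h (length-++ L) (cong length (++-identityʳ V₂)) ⟩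
          h′ (length V₁) (length V₂) ∎
    -- The letter `d` exceeds `z` and still has to be placed, so every continuation is blocked.
    inner U₁ z (d ∷ U₂) refl = trans
      (Σsplit-diag U₁ (λ _ _ → 0) λ where
        V₁ y V₂ refl → Σarr-blocked k ((L ++ V₁) ++ (V₂ ++ d ∷ U₂)) z y (f y)
          (trans (length-++ (L ++ V₁)) (peak-length L V₁ V₂ (d ∷ U₂) e))
          (∈-++⁺ʳ (L ++ V₁) (∈-++⁺ʳ V₂ (here refl)))
          (L.head (sorted-after (L ++ (V₁ ++ y ∷ V₂)) (peak-sorted₁ L V₁ V₂ (d ∷ U₂) s))))
      (Σdiag-zero (length U₁))

module Blocking-142-3 {n : ℕ} where
  Blocks : (z y d : Fin n) → Set
  Blocks z y d = y Fin.< d × d Fin.< z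

  blocks? : ∀ z y → Decidable (Blocks z y)
  blocks? z y d = (y Fin.<? d) ×-dec (d Fin.<? z)

  open Blocking Blocks blocks?

  -- A peak is allowed only when y is the predecessor of z in U, and z is arbitrary otherwise.
  peakSum : PeakSum
  peakSum {k} f h L U s e H = trans (Σsplit-diag U t inner) (Σdiag-t (length U))
    where
    h′ : ℕ → ℕ → ℕ
    h′ i j = h (length L + i) j

    t : ℕ → ℕ → ℕ
    t zero    c = 0
    t (suc b) c = h′ b c

    -- The smallest letter of `U` has no predecessor in `U`, so the term `b = 0` vanishes and the
    -- others shift by one, which gives the `pred`.
    Σdiag-t : ∀ m → Σdiag m t ≡ Σdiag (pred m) h′
    Σdiag-t zero    = refl
    Σdiag-t (suc m) = refl

    r : ℕ → ℕ → ℕ → ℕ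
    r c b zero    = h′ b c
    r c b (suc _) = 0

    Σdiag-r : ∀ b c → Σdiag b (r c) ≡ t b c
    Σdiag-r zero    c = refl
    Σdiag-r (suc b) c = trans (Σdiag-last b (r c)) (cong (_+ h′ b c) (Σdiag-zero b))

    inner : ∀ U₁ z U₂ → U ≡ U₁ ++ z ∷ U₂ →
      Σsplit U₁ (λ V₁ y V₂ →
        Σarr ((L ++ V₁) ++ (V₂ ++ U₂)) k (λ v → [ unblocked? z y v ]· f y v))
      ≡ t (length U₁) (length U₂)
    inner U₁ z U₂ refl = trans (Σsplit-diag U₁ (r (length U₂)) inner′) (Σdiag-r (length U₁) (length U₂))
      where
      inner′ : ∀ V₁ y V₂ → U₁ ≡ V₁ ++ y ∷ V₂ →
        Σarr ((L ++ V₁) ++ (V₂ ++ U₂)) k (λ v → [ unblocked? z y v ]· f y v)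
        ≡ r (length U₂) (length V₁) (length V₂)
      inner′ V₁ y [] refl = begin
        Σarr ((L ++ V₁) ++ U₂) k (λ v → [ unblocked? z y v ]· f y v)
          ≡⟨ Σarr-unblocked k ((L ++ V₁) ++ U₂) z y (f y) (trans (length-++ (L ++ V₁)) size)
               (L.++⁺
                 (L.map (λ d<y (y<d , _) → Fin.<-asym d<y y<d)
                   (sorted-before (L ++ V₁) (peak-sorted₂ L V₁ [] U₂ s)))
                 (L.map (λ z<d (_ , d<z) → Fin.<-asym z<d d<z)
                   (sorted-after (L ++ (V₁ ++ y ∷ [])) (peak-sorted₁ L V₁ [] U₂ s)))) ⟩
        Σarr ((L ++ V₁) ++ U₂) k (f y)
          ≡⟨ H (L ++ V₁) y U₂ (peak-sorted₃ L V₁ [] U₂ s) size ⟩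
        h (length (L ++ V₁)) (length U₂)
          ≡⟨ cong (λ m → h m (length U₂)) (length-++ L) ⟩
        h′ (length V₁) (length U₂) ∎
        where
        size : length (L ++ V₁) + length U₂ ≡ k
        size = peak-length L V₁ [] U₂ e
      inner′ V₁ y (d ∷ V₂) refl =
        Σarr-blocked k ((L ++ V₁) ++ (d ∷ V₂ ++ U₂)) z y (f y)
          (trans (length-++ (L ++ V₁)) (peak-length L V₁ (d ∷ V₂) U₂ e))
          (∈-++⁺ʳ (L ++ V₁) (here refl))
          ( L.head (sorted-after (L ++ V₁) (peak-sorted₂ L V₁ (d ∷ V₂) U₂ s))
          , L.head (L.tail (L.++⁻ʳ V₁ (L.++⁻ʳ L
              (sorted-before (L ++ (V₁ ++ y ∷ d ∷ V₂)) (peak-sorted₁ L V₁ (d ∷ V₂) U₂ s))))))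

-- From pattern avoidance to blocking relations.

-- Descent and Contains from Defs, for a word length k independent of the alphabet so that
-- induction on the word is possible; they agree definitionally when k = n.

DescentAt : Vec (Fin n) k → Fin k → Set
DescentAt v i = ∃[ j ] Adjacent i j × lookup v j Fin.< lookup v i

descentAt? : (v : Vec (Fin n) k) → Decidable (DescentAt v)
descentAt? v i = Fin.any? λ j → adjacent? i j ×-dec (lookup v j Fin.<? lookup v i)

-- Position `zero` compares `x` with `y`, and position `suc i` of `x ∷ y ∷ v` behaves as position
-- `i` of `y ∷ v`.
count-descents : (v : Vec (Fin n) k) → length (filter (descentAt? v) (allFin k)) ≡ descents v
count-descents v = trans (length-filter-sum (descentAt? v) (allFin _)) (go v)
  where
  go : (v : Vec (Fin n) k) → sum (List.map (λ i → [ descentAt? v i ]· 1) (allFin k)) ≡ descents v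
  go []          = refl
  go (x ∷ [])    = refl
  go (x ∷ y ∷ v) = cong₂ _+_
    ([]·-⇔ (mk⇔ (λ { (suc zero , _ , y<x) → y<x }) (λ y<x → suc zero , refl , y<x))
      (descentAt? (x ∷ y ∷ v) zero) (y Fin.<? x) 1)
    (begin
      sum (List.map (λ i → [ descentAt? (x ∷ y ∷ v) i ]· 1) (List.tabulate suc))
        ≡⟨ cong sum (map-tabulate suc (λ i → [ descentAt? (x ∷ y ∷ v) i ]· 1)) ⟩
      sum (List.tabulate (λ i → [ descentAt? (x ∷ y ∷ v) (suc i) ]· 1))
        ≡⟨ cong sum (map-tabulate (λ i → i) (λ i → [ descentAt? (x ∷ y ∷ v) (suc i) ]· 1)) ⟨
      sum (List.map (λ i → [ descentAt? (x ∷ y ∷ v) (suc i) ]· 1) (allFin _))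
        ≡⟨ cong sum (map-cong (λ i → []·-⇔
             (mk⇔ (λ { (suc j , a , d) → j , suc-injective a , d })
                  (λ { (j , a , d) → suc j , cong suc a , d }))
             (descentAt? (x ∷ y ∷ v) (suc i)) (descentAt? (y ∷ v) i) 1) (allFin _)) ⟩
      sum (List.map (λ i → [ descentAt? (y ∷ v) i ]· 1) (allFin _))
        ≡⟨ go (y ∷ v) ⟩
      descents (y ∷ v) ∎)

OccursAt : Pattern → Vec (Fin n) k → (i i′ i″ j : Fin k) → Set
OccursAt p v i i′ i″ j =
  Adjacent i i′ × Adjacent i′ i″ × i″ Fin.< j ×
  OrderIsomorphic (Vec.map (lookup v) (i ∷ i′ ∷ i″ ∷ j ∷ [])) p

Occurs : Pattern → Vec (Fin n) k → Set
Occurs p v = ∃[ i ] ∃[ i′ ] ∃[ i″ ] ∃[ j ] OccursAt p v i i′ i″ j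

module Avoidance {n : ℕ} (p : Pattern) (B : Fin n → Fin n → Fin n → Set) (B? : ∀ z y → Decidable (B z y))
  (pattern⇔ : ∀ x z y d → OrderIsomorphic (x ∷ z ∷ y ∷ d ∷ []) p ⇔ (x Fin.< y × y Fin.< z × B z y d))
  where

  open Blocking B B?

  avoids⇒allowed : (v : Vec (Fin n) k) → ¬ Occurs p v → Allowed v
  avoids⇒allowed []      ¬o = tt
  avoids⇒allowed (x ∷ v) ¬o =
    start v ¬o , avoids⇒allowed v λ where
      (i , i′ , i″ , j , a , a′ , lt , iso) →
        ¬o (suc i , suc i′ , suc i″ , suc j , cong suc a , cong suc a′ , s<s lt , iso)
    where
    start : ∀ {k} (v : Vec (Fin n) k) → ¬ Occurs p (x ∷ v) → StartAllowed x v
    start []          ¬o = tt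
    start (z ∷ [])    ¬o = tt
    start (z ∷ y ∷ w) ¬o x<y y<z = V.lookup⁻ λ j b →
      ¬o (zero , suc zero , suc (suc zero) , suc (suc (suc j)) , refl , refl , s<s (s<s z<s) ,
          Equivalence.from (pattern⇔ x z y (lookup w j)) (x<y , y<z , b))

  -- An occurrence at the front has its first three letters at `x`, `z`, `y` by adjacency and its
  -- fourth in `w`, against the condition at `x`; any other lies wholly in the tail.
  allowed⇒avoids : (v : Vec (Fin n) k) → Allowed v → ¬ Occurs p v
  allowed⇒avoids (x ∷ z ∷ y ∷ w) (start , _)
    (zero , suc zero , suc (suc zero) , suc (suc (suc j)) , _ , _ , _ , iso)
    with x<y , y<z , b ← Equivalence.to (pattern⇔ x z y (lookup w j)) iso
    = V.lookup⁺ (start x<y y<z) j b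
  allowed⇒avoids (x ∷ z ∷ y ∷ w) _
    (zero , suc zero , suc (suc zero) , suc (suc zero) , _ , _ , s<s (s<s ()) , _)
  allowed⇒avoids (x ∷ z ∷ y ∷ w) _
    (zero , suc zero , suc (suc zero) , suc zero , _ , _ , s<s () , _)
  allowed⇒avoids (x ∷ z ∷ []) _ (zero , suc zero , suc zero , _ , _ , () , _)
  allowed⇒avoids (x ∷ v) (_ , allowed) (suc i , suc i′ , suc i″ , suc j , a , a′ , lt , iso) =
    allowed⇒avoids v allowed
      (i , i′ , i″ , j , suc-injective a , suc-injective a′ , s<s⁻¹ lt , iso)

  -- Being a permutation turns words into arrangements; avoidance and the value of `des` merge into
  -- `weight g`, with `g` the indicator of `m`.
  card-avoiders : PeakSum → ∀ m →
    card {n} (λ π → avoiding? p π ×-dec (des π ℕ.≟ m)) ≡ totalWeight n (λ d → [ d ℕ.≟ m ]· 1)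
  card-avoiders peakSum m = begin
    card {n} (λ π → avoiding? p π ×-dec (des π ℕ.≟ m))
      ≡⟨ length-filter-sum (λ π → avoiding? p π ×-dec (des π ℕ.≟ m)) (allVecs n n) ⟩
    sum (List.map (λ π → [ avoiding? p π ×-dec (des π ℕ.≟ m) ]· 1) (allVecs n n))
      ≡⟨ sum-allVecs n n _ ⟩
    Σword (allFin n) n (λ π → [ avoiding? p π ×-dec (des π ℕ.≟ m) ]· 1)
      ≡⟨ Σword-cong n (allFin n) indicator ⟩
    Σword (allFin n) n (λ π → [ isPermutation? π ]· weight g π)
      ≡⟨ Σword-unique n (allFin n) (weight g) sorted ⟩
    Σarr (allFin n) n (weight g)
      ≡⟨ Σ-weight peakSum n g (allFin n) sorted (length-tabulate (λ i → i)) ⟩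
    totalWeight n g ∎
    where
    g : ℕ → ℕ
    g d = [ d ℕ.≟ m ]· 1

    sorted : Sorted (allFin n)
    sorted = AllPairs.tabulate⁺-< (λ i<j → i<j)

    indicator : ∀ π → [ avoiding? p π ×-dec (des π ℕ.≟ m) ]· 1 ≡ [ isPermutation? π ]· weight g π
    indicator π = begin
      [ avoiding? p π ×-dec (des π ℕ.≟ m) ]· 1
        ≡⟨ []·-× (avoiding? p π) (des π ℕ.≟ m) 1 ⟩
      [ isPermutation? π ×-dec ¬? (contains? p π) ]· g (des π)
        ≡⟨ []·-× (isPermutation? π) (¬? (contains? p π)) _ ⟩
      [ isPermutation? π ]· [ ¬? (contains? p π) ]· g (des π)
        ≡⟨ cong ([ isPermutation? π ]·_) ([]·-⇔ (mk⇔ (avoids⇒allowed π) (allowed⇒avoids π))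
             (¬? (contains? p π)) (allowed? π) _) ⟩
      [ isPermutation? π ]· [ allowed? π ]· g (des π)
        ≡⟨ cong (λ d → [ isPermutation? π ]· [ allowed? π ]· g d) (count-descents π) ⟩
      [ isPermutation? π ]· weight g π ∎

-- The two patterns as chains of inequalities, and the equivalence.

rank : Fin 4 → ℕ
rank i = suc (toℕ i)

-- With the letters sorted as `w`, both the subsequence and the pattern are `q` read through an
-- increasing map, so both comparisons reduce to comparing entries of `q`. This avoids checking
-- sixteen pairs.
increasing-orderIsomorphic : {w : Vec (Fin n) 4} → Linked Fin._<_ w → (q : Vec (Fin 4) 4) →
  OrderIsomorphic (Vec.map (lookup w) q) (Vec.map rank q)
increasing-orderIsomorphic {w = w} inc q s t
  rewrite lookup-map s (lookup w) q | lookup-map t (lookup w) q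
        | lookup-map s rank q | lookup-map t rank q
  = mk⇔ (λ lt → s<s (reflects lt)) (λ lt → Linked.lookup⁺ Fin.<-trans inc (s<s⁻¹ lt))
  where
  reflects : ∀ {i j} → lookup w i Fin.< lookup w j → i Fin.< j
  reflects {i} {j} lt with Fin.<-cmp i j
  ... | tri< i<j _ _  = i<j
  ... | tri≈ _ refl _ = contradiction lt (Fin.<-irrefl refl)
  ... | tri> _ _ j<i  = contradiction lt (Fin.<-asym (Linked.lookup⁺ Fin.<-trans inc j<i))

132-4⇔ : (x z y d : Fin n) →
  OrderIsomorphic (x ∷ z ∷ y ∷ d ∷ []) (1 ∷ 3 ∷ 2 ∷ 4 ∷ []) ⇔ (x Fin.< y × y Fin.< z × z Fin.< d)
132-4⇔ x z y d = mk⇔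
  -- The values 1, 2, 3, 4 sit at positions 0, 2, 1, 3, and consecutive values are compared; `1 < 2`
  -- unfolds to `2 ≤ 2`.
  (λ iso → Equivalence.from (iso (# 0) (# 2)) (≤ᵇ⇒≤ 2 2 tt)
         , Equivalence.from (iso (# 2) (# 1)) (≤ᵇ⇒≤ 3 3 tt)
         , Equivalence.from (iso (# 1) (# 3)) (≤ᵇ⇒≤ 4 4 tt))
  (λ (x<y , y<z , z<d) → increasing-orderIsomorphic (x<y ∷ y<z ∷ z<d ∷ [-]) (# 0 ∷ # 2 ∷ # 1 ∷ # 3 ∷ []))

142-3⇔ : (x z y d : Fin n) →
  OrderIsomorphic (x ∷ z ∷ y ∷ d ∷ []) (1 ∷ 4 ∷ 2 ∷ 3 ∷ []) ⇔ (x Fin.< y × y Fin.< z × (y Fin.< d × d Fin.< z))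
142-3⇔ x z y d = mk⇔
  (λ iso → Equivalence.from (iso (# 0) (# 2)) (≤ᵇ⇒≤ 2 2 tt)
         , Equivalence.from (iso (# 2) (# 1)) (≤ᵇ⇒≤ 3 4 tt)
         , Equivalence.from (iso (# 2) (# 3)) (≤ᵇ⇒≤ 3 3 tt)
         , Equivalence.from (iso (# 3) (# 1)) (≤ᵇ⇒≤ 4 4 tt))
  -- The sorted letters are `x`, `y`, `d`, `z`; the indices 0, 3, 1, 2 read them back as `x z y d`.
  (λ (x<y , y<z , y<d , d<z) → increasing-orderIsomorphic (x<y ∷ y<d ∷ d<z ∷ [-]) (# 0 ∷ # 3 ∷ # 1 ∷ # 2 ∷ []))

theorem3p6 : (1 ∷ 3 ∷ 2 ∷ 4 ∷ []) ∼des (1 ∷ 4 ∷ 2 ∷ 3 ∷ [])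
theorem3p6 n m _ = trans
  (Avoidance.card-avoiders {n} (1 ∷ 3 ∷ 2 ∷ 4 ∷ []) B₁.Blocks B₁.blocks? 132-4⇔ B₁.peakSum m)
  (sym (Avoidance.card-avoiders {n} (1 ∷ 4 ∷ 2 ∷ 3 ∷ []) B₂.Blocks B₂.blocks? 142-3⇔ B₂.peakSum m))
  where
  module B₁ = Blocking-132-4
  module B₂ = Blocking-142-3
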